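{- Every $0$-map graph has a vertex whose neighborhood is the union of $3$ cliques.
   Context: Graphs are finite, simple and have at least one vertex. The neighborhood of a vertex $v$ is the set of vertices adjacent to $v$; cliques are sets of pairwise adjacent vertices, and in "union of $3$ cliques" the cliques may overlap or be empty (i.e. the neighborhood induces a subgraph with clique cover number at most $3$). $0$-map graph: start with a plane graph $G_0$ (a graph embedded in the sphere, equivalently the plane), with each face (including the outer face) labeled a nation or a lake; $G$ is the graph whose vertices are the nations, two distinct vertices being adjacent iff the corresponding faces share a vertex of $G_0$. Equivalently, there is a planar bipartite graph $H$ with bipartition $(X,Y)$ such that $V(G)=X$ and two distinct vertices of $X$ are adjacent in $G$ iff they have a common neighbor in $Y$. -}

module Defs where

open import Level using (0ℓ)
open import Data.Fin using (Fin)
open import Data.Fin.Permutation using (Permutation′; _⟨$⟩ʳ_; _∘ₚ_)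
open import Data.Fin.Subset using (Subset; _∈_; _∪_)
open import Data.Nat using (ℕ; _+_; _*_)
open import Data.Product using (Σ-syntax; ∃-syntax; _×_)
open import Data.Sum using (_⊎_; inj₁; inj₂)
open import Data.Vec using (tabulate)
open import Function.Bundles using (_⇔_)
open import Function.Definitions using (Surjective)
open import Relation.Binary.Core using (Rel)
open import Relation.Binary.Definitions using (Symmetric; Irreflexive; Decidable)
open import Relation.Binary.Construct.Closure.Equivalence using (EqClosure)
open import Relation.Binary.PropositionalEquality using (_≡_; _≢_)
open import Relation.Nullary using (¬_; does)

-- Simple graphs.  They are only used with V = Fin n or V = Fin n ⊎ Fin m,
-- so all graphs below are finite.
record Graph (V : Set) : Set₁ where
  field
    Adj     : Rel V 0ℓ
    adj?    : Decidable Adj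
    symm    : Symmetric Adj
    irrefl  : Irreflexive _≡_ Adj

open Graph public

module _ {n : ℕ} (G : Graph (Fin n)) where

  neighbourhood : Fin n → Subset n
  neighbourhood v = tabulate (λ u → does (adj? G v u))

  IsClique : Subset n → Set
  IsClique K = ∀ u v → u ∈ K → v ∈ K → u ≢ v → Adj G u v

  -- The cliques may be empty and may overlap.
  IsUnionOf3Cliques : Subset n → Set
  IsUnionOf3Cliques S =
    ∃[ A ] ∃[ B ] ∃[ C ]
      IsClique A × IsClique B × IsClique C × S ≡ A ∪ B ∪ C

-- The equivalence relation generated by R has exactly k classes.
HasClasses : {d : ℕ} → Rel (Fin d) 0ℓ → ℕ → Set
HasClasses {d} R k =
  Σ[ class ∈ (Fin d → Fin k) ]
    Surjective _≡_ _≡_ class ×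
    (∀ i j → class i ≡ class j ⇔ EqClosure R i j)

-- A combinatorial map: a cellular decomposition of closed oriented surfaces,
-- one surface for each connected component.  A dart is an edge with a choice
-- of direction; α reverses a dart and σ sends a dart to the next one, in the
-- rotation of the surface, with the same tail.
record CombinatorialMap : Set where
  field
    #darts       : ℕ
    σ α          : Permutation′ #darts
    α-involutive : ∀ d → α ⟨$⟩ʳ (α ⟨$⟩ʳ d) ≡ d
    α-fixfree    : ∀ d → α ⟨$⟩ʳ d ≢ d

  Dart : Set
  Dart = Fin #darts

  -- Boundary walks of faces are the orbits of d ↦ σ (α d)
  -- (_∘ₚ_ composes from left to right).
  φ : Permutation′ #darts
  φ = α ∘ₚ σ

  Step : Permutation′ #darts → Rel Dart 0ℓ
  Step π d e = π ⟨$⟩ʳ d ≡ e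

  Joined : Rel Dart 0ℓ
  Joined d e = Step σ d e ⊎ Step α d e

-- Euler's formula.  Every component satisfies v - e + f = 2 - 2g with g ≥ 0,
-- so the formula v - e + f = 2c for the totals says that every component is
-- drawn on a sphere.  Since only darts are counted, isolated vertices do not
-- occur here (each would add 1 to v, f and c, preserving the formula).
IsSpherical : CombinatorialMap → Set
IsSpherical M =
  ∃[ v ] ∃[ e ] ∃[ f ] ∃[ c ]
    HasClasses (Step σ) v × HasClasses (Step α) e ×
    HasClasses (Step φ) f × HasClasses Joined c ×
    v + f ≡ e + 2 * c
  where open CombinatorialMap M

-- M is a map whose underlying graph is H (up to the isolated vertices of H).
record Represents {V : Set} (M : CombinatorialMap) (H : Graph V) : Set where
  open CombinatorialMap M
  field
    tail : Dart → V

  head : Dart → V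
  head d = tail (α ⟨$⟩ʳ d)

  field
    rotation : ∀ d e → tail d ≡ tail e ⇔ EqClosure (Step σ) d e
    edges    : ∀ u v → Adj H u v ⇔ (∃[ d ] tail d ≡ u × head d ≡ v)
    simple   : ∀ d e → tail d ≡ tail e → head d ≡ head e → d ≡ e

-- Planarity: the graph has an embedding in the sphere, given by its rotation
-- system.  Disconnected graphs are allowed, as a graph embeds in the sphere
-- iff each of its components does.
IsPlanar : {V : Set} → Graph V → Set
IsPlanar H = ∃[ M ] IsSpherical M × Represents M H

IsBipartite : {X Y : Set} → Graph (X ⊎ Y) → Set
IsBipartite H =
  (∀ x x′ → ¬ Adj H (inj₁ x) (inj₁ x′)) ×
  (∀ y y′ → ¬ Adj H (inj₂ y) (inj₂ y′))

-- The left summand Fin n of the vertex set of H is the set of nations.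
Is0MapGraph : {n : ℕ} → Graph (Fin n) → Set₁
Is0MapGraph {n} G =
  Σ[ m ∈ ℕ ] Σ[ H ∈ Graph (Fin n ⊎ Fin m) ]
    IsBipartite H × IsPlanar H ×
    (∀ u v → Adj G u v ⇔
      (u ≢ v × ∃[ y ] Adj H (inj₁ u) (inj₂ y) × Adj H (inj₁ v) (inj₂ y)))

{-# OPTIONS --safe #-}
module Submission where

-- Discharging.  Let H be the bipartite plane graph, and join consecutive nations around each vertex
-- of Y and around each face of H: this gives a map on the nations whose faces are the vertices of Y
-- and the faces of H.  Vertices of Y of degree 1 would yield loops; they are skipped.  Give every
-- vertex, edge and face the charge 1, -1 and 1; Euler's formula makes the total positive.  Moving
-- the charge of edges and faces to the nations, a nation x keeps 1 - Σ (1/2 - 1/|f|), summed over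
-- the corners at x, where f is the face in the corner.  Rounding faces of length ≥ 4 down to 4 and
-- scaling by 12, the corners at some x cost less than 12 in total, where a digon costs 0, a triangle
-- 2 and any larger face 3.  So there are at most five corners that are not digons; if there are
-- four then one is a triangle, and if there are five then at least four are.  Since triangles and
-- the faces coming from Y are cliques, three cliques suffice in each case.

open import Data.Bool using (if_then_else_)
open import Data.Empty using (⊥)
open import Data.Fin using (Fin; zero; suc; toℕ)
open import Data.Fin.Permutation using (_⟨$⟩ʳ_; _⟨$⟩ˡ_; inverseˡ; inverseʳ)
open import Data.Fin.Properties using (_≟_; any?; ¬Fin0; pigeonhole)
open import Data.Fin.Subset using (Subset; _∈_; _∪_; _∩_; ⁅_⁆)
open import Data.Fin.Subset.Properties using (⊆-antisym; x∈p∪q⁺; x∈p∪q⁻; x∈p∩q⁺; x∈p∩q⁻; x∈⁅x⁆; x∈⁅y⁆⇒x≡y)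
open import Data.List using (List; []; _∷_; map; applyUpTo)
open import Data.List.Properties using (map-cong-local)
open import Data.List.Relation.Unary.All using (All; []; _∷_)
open import Data.List.Relation.Unary.All.Properties using (applyUpTo⁺₂)
open import Data.List.Relation.Unary.AllPairs using ([]; _∷_)
open import Data.List.Relation.Unary.Unique.Propositional using (Unique)
open import Data.List.Relation.Unary.Unique.Propositional.Properties using (applyUpTo⁺₁)
open import Data.Nat using (ℕ; zero; suc; _+_; _*_; _∸_; _≤_; _<_; _≥_; z≤n; s≤s; s≤s⁻¹; _<?_)
open import Data.Nat.GeneralisedArithmetic using (iterate)
import Data.Nat.ListAction as List
open import Data.Nat.Properties hiding (_≟_)
open import Data.Product using (∃-syntax; Σ-syntax; _×_; _,_; proj₁; proj₂)
open import Data.Sum using (_⊎_; inj₁; inj₂; [_,_]; [_,_]′)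
open import Data.Sum.Properties using (≡-dec; inj₁-injective)
open import Data.Vec using (tabulate)
open import Data.Vec.Properties using ([]=⇒lookup; lookup⇒[]=; lookup∘tabulate)
open import Function using (_∘_; id; const; case_of_; mk⇔; Equivalence)
open import Function.Bundles using (_⇔_)
open import Function.Definitions using (Injective)
open import Relation.Binary.Construct.Closure.Equivalence using (EqClosure)
open import Relation.Binary.Construct.Closure.ReflexiveTransitive using (ε; _◅_; _◅◅_)
open import Relation.Binary.Construct.Closure.Symmetric using (fwd; bwd)
open import Relation.Binary.PropositionalEquality hiding ([_])
open import Relation.Nullary using (¬_; Dec; yes; no; does; contradiction; ¬?)
open import Relation.Nullary.Decidable using (does-⇔; dec-true; dec-false; decidable-stable; _×-dec_)
open import Relation.Unary using (Decidable)
open import Algebra.Properties.CommutativeMonoid.Sum +-0-commutativeMonoid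
  using (sum; sum-cong-≗; ∑-distrib-+; ∑-comm)

open import Defs

open Equivalence using (to; from)

private
  variable
    n k : ℕ
    A : Set

-- Finite sums

sum-mono-≤ : {f g : Fin n → ℕ} → (∀ i → f i ≤ g i) → sum f ≤ sum g
sum-mono-≤ {zero}  f≤g = z≤n
sum-mono-≤ {suc n} f≤g = +-mono-≤ (f≤g zero) (sum-mono-≤ (f≤g ∘ suc))

*≤sum : ∀ {c} {f : Fin n → ℕ} → (∀ i → c ≤ f i) → n * c ≤ sum f
*≤sum {zero}  c≤f = z≤n
*≤sum {suc n} c≤f = +-mono-≤ (c≤f zero) (*≤sum (c≤f ∘ suc))

sum≤* : ∀ {c} {f : Fin n → ℕ} → (∀ i → f i ≤ c) → sum f ≤ n * c
sum≤* {zero}  f≤c = z≤n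
sum≤* {suc n} f≤c = +-mono-≤ (f≤c zero) (sum≤* (f≤c ∘ suc))

sum-zero : (f : Fin n → ℕ) → (∀ i → f i ≡ 0) → sum f ≡ 0
sum-zero {zero}  f f≡0 = refl
sum-zero {suc n} f f≡0 = cong₂ _+_ (f≡0 zero) (sum-zero (f ∘ suc) (f≡0 ∘ suc))

infix 3 _when_

_when_ : {P : Set} → ℕ → Dec P → ℕ
c when p? = if does p? then c else 0

when-yes : ∀ {P : Set} {c} (p? : Dec P) → P → (c when p?) ≡ c
when-yes p? p rewrite dec-true p? p = refl

when-no : ∀ {P : Set} {c} (p? : Dec P) → ¬ P → (c when p?) ≡ 0
when-no p? ¬p rewrite dec-false p? ¬p = refl

sum-when : (f : Fin n → ℕ) (i : Fin n) → sum (λ j → f j when i ≟ j) ≡ f i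
sum-when {suc n} f zero = trans (cong (f zero +_) (sum-zero {n} (λ _ → 0) (λ _ → refl))) (+-identityʳ _)
sum-when f (suc i) = sum-when (f ∘ suc) i

sum-fibres : (class : Fin n → Fin k) (f : Fin n → ℕ) →
             sum (λ j → sum (λ i → f i when class i ≟ j)) ≡ sum f
sum-fibres class f = trans (∑-comm (λ j i → f i when class i ≟ j))
                           (sum-cong-≗ (λ i → sum-when (λ _ → f i) (class i)))

classes*≤sum : ∀ {c} (class : Fin n → Fin k) (f : Fin n → ℕ) →
               (∀ j → c ≤ sum (λ i → f i when class i ≟ j)) → k * c ≤ sum f
classes*≤sum class f c≤ = ≤-trans (*≤sum c≤) (≤-reflexive (sum-fibres class f))

sum≤classes* : ∀ {c} (class : Fin n → Fin k) (f : Fin n → ℕ) →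
               (∀ j → sum (λ i → f i when class i ≟ j) ≤ c) → sum f ≤ k * c
sum≤classes* class f ≤c = ≤-trans (≤-reflexive (sym (sum-fibres class f))) (sum≤* ≤c)

-- The tail of the list is summed against `rest`, which is `f` with its value at `i` set to 0.
-- Distinctness makes this invisible to the tail, and the value at `i` is then free to pay for the
-- head.
sum-unique : (f : Fin n → ℕ) {is : List (Fin n)} → Unique is →
             List.sum (map f is) ≤ sum f
sum-unique f []                        = z≤n
sum-unique f {i ∷ is} (i∉is ∷ is-uniq) = begin
  f i + List.sum (map f is)              ≡⟨ cong (f i +_) (map-rest i∉is) ⟩
  f i + List.sum (map rest is)           ≤⟨ +-monoʳ-≤ (f i) (sum-unique rest is-uniq) ⟩
  f i + sum rest                         ≡⟨ cong (_+ sum rest) (sum-when f i) ⟨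
  sum (λ j → f j when i ≟ j) + sum rest  ≡⟨ ∑-distrib-+ (λ j → f j when i ≟ j) rest ⟨
  sum (λ j → (f j when i ≟ j) + rest j)  ≡⟨ sum-cong-≗ split ⟩
  sum f                                  ∎
  where
  open ≤-Reasoning
  rest : Fin _ → ℕ
  rest j = if does (i ≟ j) then 0 else f j
  map-rest : ∀ {js} → All (i ≢_) js → List.sum (map f js) ≡ List.sum (map rest js)
  map-rest []                = refl
  map-rest {j ∷ _} (i≢j ∷ i∉js) rewrite dec-false (i ≟ j) i≢j = cong (f j +_) (map-rest i∉js)
  split : ∀ j → (f j when i ≟ j) + rest j ≡ f j
  split j with i ≟ j
  ... | yes _ = +-identityʳ (f j)
  ... | no  _ = refl

-- Iterates and periods of injections

iterate-suc : (f : A → A) (x : A) (j : ℕ) → iterate f (f x) j ≡ f (iterate f x j)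
iterate-suc f x zero    = refl
iterate-suc f x (suc j) = iterate-suc f (f x) j

iterate-+ : (f : A → A) (x : A) (i j : ℕ) →
            iterate f x (i + j) ≡ iterate f (iterate f x i) j
iterate-+ f x zero    j = refl
iterate-+ f x (suc i) j = iterate-+ f (f x) i j

iterate-injective : {f : A → A} → Injective _≡_ _≡_ f → ∀ j {x y} →
                    iterate f x j ≡ iterate f y j → x ≡ y
iterate-injective f-inj zero    eq = eq
iterate-injective f-inj (suc j) eq = f-inj (iterate-injective f-inj j eq)

iterate-cancel : {f : A → A} → Injective _≡_ _≡_ f → ∀ {x} i j → i ≤ j →
                 iterate f x i ≡ iterate f x j → iterate f x (j ∸ i) ≡ x
iterate-cancel f-inj {x} i j i≤j eq = sym (iterate-injective f-inj i
  (trans eq (trans (cong (iterate _ x) (sym (m∸n+n≡m i≤j))) (iterate-+ _ x (j ∸ i) i))))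

-- The period is `suc p`, which makes it positive by construction.
Periodic : (A → A) → A → ℕ → Set
Periodic f x p = iterate f x (suc p) ≡ x

-- Two of the first `n + 1` iterates coincide, and injectivity cancels their common initial part.
periodic : {f : Fin n → Fin n} → Injective _≡_ _≡_ f → ∀ i → ∃[ p ] Periodic f i p
periodic {n} {f} f-inj i with pigeonhole (n<1+n n) (iterate f i ∘ toℕ)
... | a , b , a<b , eq with toℕ b ∸ toℕ a in b-a | iterate-cancel f-inj (toℕ a) (toℕ b) (<⇒≤ a<b) eq
... | zero  | _      = contradiction (m∸n≡0⇒m≤n b-a) (<⇒≱ a<b)
... | suc p | p-per  = p , p-per

least : {P : ℕ → Set} → Decidable P → ∀ {p} → P p →
        ∃[ q ] P q × (∀ r → r < q → ¬ P r)
least {P} P? {p} Pp = search 0 p (+-identityʳ p) (λ _ ())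
  where
  search : ∀ q fuel → fuel + q ≡ p → (∀ r → r < q → ¬ P r) →
           ∃[ q ] P q × (∀ r → r < q → ¬ P r)
  search q fuel eq below with P? q
  ... | yes Pq = q , Pq , below
  -- With no fuel left, `q` equals `p`, where `P` is known to hold.
  search q zero eq below       | no ¬Pq = contradiction (subst P (sym eq) Pp) ¬Pq
  search q (suc fuel) eq below | no ¬Pq =
    search (suc q) fuel (trans (+-suc fuel q) eq) λ r r<1+q →
      case m≤n⇒m<n∨m≡n (s≤s⁻¹ r<1+q) of λ where
        (inj₁ r<q)  → below r r<q
        (inj₂ refl) → ¬Pq

module _ {f : Fin n → Fin n} (f-inj : Injective _≡_ _≡_ f) (i : Fin n) where

  -- The list runs from `f i` round to `i`, the order in which a walk around a nation meets its
  -- darts later. A repetition in it would give a period shorter than the least one.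
  orbit-list : ∃[ p ] Periodic f i p × Unique (applyUpTo (iterate f (f i)) (suc p))
  orbit-list with p₀ , per₀ ← periodic f-inj i with least (λ p → iterate f i (suc p) ≟ i) {p₀} per₀
  ... | p , per , minimal = p , per , applyUpTo⁺₁ (iterate f (f i)) (suc p) distinct
    where
    distinct : ∀ {a b} → a < b → b < suc p → iterate f (f i) a ≢ iterate f (f i) b
    distinct {a} {b} a<b b<1+p eq with b ∸ a in b-a | iterate-cancel f-inj a b (<⇒≤ a<b) eq
    ... | zero  | _   = contradiction (m∸n≡0⇒m≤n b-a) (<⇒≱ a<b)
    ... | suc r | per′ = minimal r r<p (f-inj (trans (sym (iterate-suc f (f i) r)) per′))
      where
      r<p : r < p
      r<p = ≤-trans (≤-trans (≤-reflexive (sym b-a)) (m∸n≤m b a)) (s≤s⁻¹ b<1+p)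

  orbit-< : ∀ {p} → Periodic f i p → ∀ j → ∃[ q ] q < suc p × iterate f i j ≡ iterate f (f i) q
  -- The point `i` itself comes last, at index `p`.
  orbit-< {p} per zero = p , ≤-refl , sym per
  orbit-< {p} per (suc j) with orbit-< per j
  ... | q , q<1+p , eq with m≤n⇒m<n∨m≡n (s≤s⁻¹ q<1+p)
  ...   | inj₁ q<p  = suc q , s≤s q<p ,
                      trans (iterate-suc f i j) (trans (cong f eq) (sym (iterate-suc f (f i) q)))
  ...   | inj₂ refl = 0 , s≤s z≤n , trans (iterate-suc f i j) (cong f (trans eq per))

-- A backward step is replaced by going forward around the rest of the cycle.
closure⇒iterate : {f : Fin n → Fin n} → Injective _≡_ _≡_ f → ∀ {i j} →
                  EqClosure (λ i j → f i ≡ j) i j → ∃[ k ] iterate f i k ≡ j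
closure⇒iterate f-inj ε = 0 , refl
closure⇒iterate f-inj (fwd refl ◅ path) with k , eq ← closure⇒iterate f-inj path = suc k , eq
closure⇒iterate {f = f} f-inj {i} (_◅_ {j = i′} (bwd refl) path)
  with q , per ← periodic f-inj i′ | k , eq ← closure⇒iterate f-inj path =
  q + k , trans (iterate-+ f i q k) (trans (cong (λ l → iterate f l k) per) eq)

-- weight f i is 12 divided by the f-period of i, with periods above 4 counted as 4, so that the
-- weights along an orbit add up to at least 12.
abstract

  weight : (Fin n → Fin n) → Fin n → ℕ
  weight f i = if does (f i ≟ i) then 12 else
               if does (f (f i) ≟ i) then 6 else
               if does (f (f (f i)) ≟ i) then 4 else 3

  weight-1 : (f : Fin n → Fin n) (i : Fin n) → f i ≡ i → weight f i ≡ 12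
  weight-1 f i eq rewrite dec-true (f i ≟ i) eq = refl

-- The weight is an index, so that a match also evaluates the cost `6 ∸ w` of a face: 0 for a digon,
-- 2 for a triangle, 3 otherwise.
data LongPeriod (f : Fin n → Fin n) (i : Fin n) (w : ℕ) : Set where
  two   : f (f i) ≡ i → w ≡ 6 → LongPeriod f i w
  three : f (f (f i)) ≡ i → w ≡ 4 → LongPeriod f i w
  more  : w ≡ 3 → LongPeriod f i w

abstract

  longPeriod : (f : Fin n → Fin n) (i : Fin n) → f i ≢ i → LongPeriod f i (weight f i)
  longPeriod f i f≢ with f i ≟ i | f (f i) ≟ i | f (f (f i)) ≟ i
  ... | yes eq | _      | _      = contradiction eq f≢
  ... | no _   | yes eq | _      = two eq refl
  ... | no _   | no _   | yes eq = three eq refl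
  ... | no _   | no _   | no _   = more refl

weight≤6 : (f : Fin n → Fin n) (i : Fin n) → f i ≢ i → weight f i ≤ 6
weight≤6 f i f≢ with weight f i | longPeriod f i f≢
... | _ | two   _ refl = ≤-refl
... | _ | three _ refl = m≤n+m 4 2
... | _ | more refl    = m≤n+m 3 3

module _ {f : Fin n → Fin n} (f-inj : Injective _≡_ _≡_ f) where
  abstract

    weight-invariant : ∀ i → weight f (f i) ≡ weight f i
    weight-invariant i
      rewrite does-⇔ (mk⇔ f-inj (cong f)) (f (f i) ≟ f i) (f i ≟ i)
            | does-⇔ (mk⇔ f-inj (cong f)) (f (f (f i)) ≟ f i) (f (f i) ≟ i)
            | does-⇔ (mk⇔ f-inj (cong f)) (f (f (f (f i))) ≟ f i) (f (f (f i)) ≟ i) = refl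

    weight-iterate : ∀ i j → weight f (iterate f i j) ≡ weight f i
    weight-iterate i zero    = refl
    weight-iterate i (suc j) = trans (weight-iterate (f i) j) (weight-invariant i)

    private
      total : {g : Fin n → ℕ} (is : List (Fin n)) → Unique is →
              List.sum (map g is) ≡ 12 → 12 ≤ sum g
      total {g} is is-uniq eq = ≤-trans (≤-reflexive (sym eq)) (sum-unique g is-uniq)

    -- Only the first min(period, 4) points of the orbit are counted: they are distinct, and their
    -- equal weights add up to exactly 12. As `g` is constrained on the orbit alone, it can be a
    -- charge restricted to one class.
    12≤orbit-sum : (g : Fin n → ℕ) (i : Fin n) →
                   (∀ j → g (iterate f i j) ≡ weight f (iterate f i j)) → 12 ≤ sum g
    12≤orbit-sum g i g≡weight with f i ≟ i | f (f i) ≟ i | f (f (f i)) ≟ i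
                                  | (λ j → trans (g≡weight j) (weight-iterate i j))
    ... | yes _ | _     | _     | g≡ =
      total (i ∷ []) ([] ∷ []) (cong (_+ 0) (g≡ 0))
    ... | no ≢1 | yes _ | _     | g≡ =
      total (i ∷ f i ∷ []) ((≢-sym ≢1 ∷ []) ∷ [] ∷ []) (cong₂ _+_ (g≡ 0) (cong (_+ 0) (g≡ 1)))
    ... | no ≢1 | no ≢2 | yes _ | g≡ =
      total (i ∷ f i ∷ f (f i) ∷ [])
        ((≢-sym ≢1 ∷ ≢-sym ≢2 ∷ []) ∷ (≢-sym ≢1 ∘ f-inj ∷ []) ∷ [] ∷ [])
        (cong₂ _+_ (g≡ 0) (cong₂ _+_ (g≡ 1) (cong (_+ 0) (g≡ 2))))
    ... | no ≢1 | no ≢2 | no ≢3 | g≡ =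
      total (i ∷ f i ∷ f (f i) ∷ f (f (f i)) ∷ [])
        ((≢-sym ≢1 ∷ ≢-sym ≢2 ∷ ≢-sym ≢3 ∷ []) ∷
         (≢-sym ≢1 ∘ f-inj ∷ ≢-sym ≢2 ∘ f-inj ∷ []) ∷
         (≢-sym ≢1 ∘ f-inj ∘ f-inj ∷ []) ∷ [] ∷ [])
        (cong₂ _+_ (g≡ 0) (cong₂ _+_ (g≡ 1) (cong₂ _+_ (g≡ 2) (cong (_+ 0) (g≡ 3)))))

-- First return maps

module FirstReturn {f : Fin n → Fin n} (f-inj : Injective _≡_ _≡_ f)
                   {P : Fin n → Set} (P? : Decidable P) where

  -- A derivation keeps the evidence that all skipped points lie outside `P`; the later inductions
  -- along tails and faces run over it.
  data Next (i : Fin n) : Fin n → Set where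
    stop : P (f i) → Next i (f i)
    skip : ∀ {j} → ¬ P (f i) → Next (f i) j → Next i j

  Next-P : ∀ {i j} → Next i j → P j
  Next-P (stop p)   = p
  Next-P (skip _ s) = Next-P s

  next-before : ∀ i j → P (iterate f (f i) j) → ∃[ k ] Next i k
  next-before i zero    p = f i , stop p
  next-before i (suc j) p with P? (f i)
  ... | yes q = f i , stop q
  ... | no ¬q with k , s ← next-before (f i) j p = k , skip ¬q s

  -- The same relation, built from its end; this form makes injectivity a direct induction.
  data Within (i : Fin n) : Fin n → Set where
    once  : Within i (f i)
    again : ∀ {j} → Within i j → ¬ P j → Within i (f j)

  within : ∀ {i j} → Next i j → Within i j
  within (stop _)    = once
  within (skip ¬p s) = prepend ¬p (within s)
    where
    prepend : ∀ {i j} → ¬ P (f i) → Within (f i) j → Within i j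
    prepend ¬p once         = again once ¬p
    prepend ¬p (again w ¬q) = again (prepend ¬p w) ¬q

  -- Both derivations are followed backwards in step. If one stopped earlier, its starting point,
  -- which is in `P`, would be a point skipped by the other.
  within-injective : ∀ {i i′ j j′} → P i → P i′ → Within i j → Within i′ j′ → j ≡ j′ → i ≡ i′
  within-injective p p′ once         once           eq = f-inj eq
  within-injective p p′ once         (again w′ ¬q′) eq = contradiction (subst P (f-inj eq) p) ¬q′
  within-injective p p′ (again w ¬q) once           eq = contradiction (subst P (sym (f-inj eq)) p′) ¬q
  within-injective p p′ (again w ¬q) (again w′ ¬q′) eq = within-injective p p′ w w′ (f-inj eq)

  next : ∀ {i} → P i → ∃[ j ] Next i j
  next {i} p with q , per ← periodic f-inj i = next-before i q (subst P (sym per) p)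

  abstract
    -- Points outside P are fixed, so that the first return map is injective everywhere.
    return : Fin n → Fin n
    return i with P? i
    ... | yes p = proj₁ (next p)
    ... | no _  = i

    return-next : ∀ {i} → P i → Next i (return i)
    return-next {i} p with P? i
    ... | yes p = proj₂ (next p)
    ... | no ¬p = contradiction p ¬p

    return-fixed : ∀ {i} → ¬ P i → return i ≡ i
    return-fixed {i} ¬p with P? i
    ... | yes p = contradiction p ¬p
    ... | no _  = refl

    return-injective : Injective _≡_ _≡_ return
    return-injective {i} {j} eq with P? i | P? j
    ... | yes p | yes q = within-injective p q (within (proj₂ (next p))) (within (proj₂ (next q))) eq
    ... | yes p | no ¬q = contradiction (subst P eq (Next-P (proj₂ (next p)))) ¬q
    ... | no ¬p | yes q = contradiction (subst P (sym eq) (Next-P (proj₂ (next q)))) ¬p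
    ... | no _  | no _  = eq

  -- Skipping never loses a point of `P`, so each such point on the `f`-orbit is also met by the
  -- first return map.
  next-reaches : ∀ {i j} → Next i j → ∀ k → P (iterate f (f i) k) →
                 ∃[ l ] iterate f (f i) k ≡ iterate return j l
  next-reaches (stop _)    zero    p = 0 , refl
  next-reaches (skip ¬p _) zero    p = contradiction p ¬p
  next-reaches (skip _ s)  (suc k) p = next-reaches s k p
  next-reaches (stop q)    (suc k) p with l , eq ← next-reaches (return-next q) k p = suc l , eq

  return-reaches : ∀ {i} k → P i → P (iterate f i k) → ∃[ l ] iterate f i k ≡ iterate return i l
  return-reaches zero    p q = 0 , refl
  return-reaches (suc k) p q with l , eq ← next-reaches (return-next p) k q = suc l , eq

-- Subsets given by decidable predicates

∈-tabulate⁺ : ∀ {n} {P : Fin n → Set} (P? : ∀ u → Dec (P u)) {u} → P u → u ∈ tabulate (does ∘ P?)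
∈-tabulate⁺ P? {u} p = lookup⇒[]= u _ (trans (lookup∘tabulate (does ∘ P?) u) (dec-true (P? u) p))

∈-tabulate⁻ : ∀ {n} {P : Fin n → Set} (P? : ∀ u → Dec (P u)) {u} → u ∈ tabulate (does ∘ P?) → P u
∈-tabulate⁻ P? {u} u∈ with P? u | trans (sym (lookup∘tabulate (does ∘ P?) u)) ([]=⇒lookup u∈)
... | yes p | _ = p

-- Covering closed walks by three cliques

module Cliques (G : Graph (Fin n)) where

  Clique : Set
  Clique = ∃[ K ] IsClique G K

  _∈ᶜ_ : Fin n → Clique → Set
  u ∈ᶜ (K , _) = u ∈ K

  Cover3 : (Fin n → Set) → Set
  Cover3 S = ∃[ A ] ∃[ B ] ∃[ C ] (∀ u → S u → u ∈ᶜ A ⊎ u ∈ᶜ B ⊎ u ∈ᶜ C)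

  cover3-⊆ : {S T : Fin n → Set} → (∀ u → S u → T u) → Cover3 T → Cover3 S
  cover3-⊆ S⊆T (A , B , C , T⊆) = A , B , C , λ u → T⊆ u ∘ S⊆T u

  -- The covering cliques may stick out of `S`; intersecting them with `S` keeps them cliques and
  -- makes the union exact.
  cover3⇒union : (S : Subset n) → Cover3 (_∈ S) → IsUnionOf3Cliques G S
  cover3⇒union S ((A , A-clique) , (B , B-clique) , (C , C-clique) , S⊆) =
    S ∩ A , S ∩ B , S ∩ C , ∩-clique A-clique , ∩-clique B-clique , ∩-clique C-clique ,
    ⊆-antisym
      (λ u∈S → x∈p∪q⁺ ([ inj₁ ∘ both u∈S ,
        (λ u∈ → inj₂ (x∈p∪q⁺ ([ inj₁ ∘ both u∈S , inj₂ ∘ both u∈S ] u∈))) ] (S⊆ _ u∈S)))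
      (λ u∈ → [ left A , (λ u∈′ → [ left B , left C ] (x∈p∪q⁻ (S ∩ B) (S ∩ C) u∈′)) ] (x∈p∪q⁻ (S ∩ A) _ u∈))
    where
    ∩-clique : ∀ {K} → IsClique G K → IsClique G (S ∩ K)
    ∩-clique {K} K-clique u v u∈ v∈ = K-clique u v (proj₂ (x∈p∩q⁻ S K u∈)) (proj₂ (x∈p∩q⁻ S K v∈))
    both : ∀ {K u} → u ∈ S → u ∈ K → u ∈ S ∩ K
    both u∈S u∈K = x∈p∩q⁺ (u∈S , u∈K)
    left : ∀ {u} K → u ∈ S ∩ K → u ∈ S
    left K u∈ = proj₁ (x∈p∩q⁻ S K u∈)

  -- What lies in a corner at a vertex x between edges from x to a and to b: a triangle, a vertex of
  -- Y whose nations form the clique K (fan), or a long face of H, which need not be a clique (hollow).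
  data Corner (a b : Fin n) : Set where
    triangle : a ≡ b ⊎ Adj G a b → Corner a b
    fan      : (K : Clique) → a ∈ᶜ K → b ∈ᶜ K → Corner a b
    hollow   : Corner a b

  infix 4 _∈ᶠ_
  _∈ᶠ_ : ∀ {a b} → Fin n → Corner a b → Set
  u ∈ᶠ triangle _ = ⊥
  u ∈ᶠ fan K _ _  = u ∈ᶜ K
  u ∈ᶠ hollow     = ⊥

  price : ∀ {a b} → Corner a b → ℕ
  price (triangle _) = 2
  price (fan _ _ _)  = 3
  price hollow       = 3

  infixr 5 _∷_
  data Walk : Fin n → Fin n → Set where
    []  : ∀ {a} → Walk a a
    _∷_ : ∀ {a b c} → Corner a b → Walk b c → Walk a c

  infix 4 _∈ʷ_
  _∈ʷ_ : ∀ {a b} → Fin n → Walk a b → Set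
  _∈ʷ_ {a} u []      = u ≡ a
  _∈ʷ_ {a} u (c ∷ w) = u ≡ a ⊎ u ∈ᶠ c ⊎ u ∈ʷ w

  cost : ∀ {a b} → Walk a b → ℕ
  cost []      = 0
  cost (c ∷ w) = price c + cost w

  source∈ : ∀ {a b} (w : Walk a b) → a ∈ʷ w
  source∈ []      = refl
  source∈ (_ ∷ _) = inj₁ refl

  target∈ : ∀ {a b} (w : Walk a b) → b ∈ʷ w
  target∈ []      = refl
  target∈ (_ ∷ w) = inj₂ (inj₂ (target∈ w))

  _∷ʳ_ : ∀ {a b c} → Walk a b → Corner b c → Walk a c
  []      ∷ʳ d = d ∷ []
  (c ∷ w) ∷ʳ d = c ∷ (w ∷ʳ d)

  ∈-∷ʳ⁺ˡ : ∀ {a b c u} (w : Walk a b) {d : Corner b c} → u ∈ʷ w → u ∈ʷ w ∷ʳ d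
  ∈-∷ʳ⁺ˡ []      u≡a               = inj₁ u≡a
  ∈-∷ʳ⁺ˡ (c ∷ w) (inj₁ u≡a)        = inj₁ u≡a
  ∈-∷ʳ⁺ˡ (c ∷ w) (inj₂ (inj₁ u∈c)) = inj₂ (inj₁ u∈c)
  ∈-∷ʳ⁺ˡ (c ∷ w) (inj₂ (inj₂ u∈w)) = inj₂ (inj₂ (∈-∷ʳ⁺ˡ w u∈w))

  ∈-∷ʳ⁺ʳ : ∀ {a b c u} (w : Walk a b) {d : Corner b c} → u ≡ c ⊎ u ∈ᶠ d → u ∈ʷ w ∷ʳ d
  ∈-∷ʳ⁺ʳ []      (inj₁ u≡c) = inj₂ (inj₂ u≡c)
  ∈-∷ʳ⁺ʳ []      (inj₂ u∈d) = inj₂ (inj₁ u∈d)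
  ∈-∷ʳ⁺ʳ (c ∷ w) u∈         = inj₂ (inj₂ (∈-∷ʳ⁺ʳ w u∈))

  -- A closed walk visits the same nations from any starting point, so a distinguished corner can be
  -- brought to the front.
  rotate : ∀ {a b} (c : Corner a b) (w : Walk b a) → Cover3 (_∈ʷ w ∷ʳ c) → Cover3 (_∈ʷ c ∷ w)
  rotate {a} c w = cover3-⊆ moved
    where
    moved : ∀ u → u ∈ʷ c ∷ w → u ∈ʷ w ∷ʳ c
    moved u (inj₁ refl)       = ∈-∷ʳ⁺ˡ w (target∈ w)
    moved u (inj₂ (inj₁ u∈c)) = ∈-∷ʳ⁺ʳ w (inj₂ u∈c)
    moved u (inj₂ (inj₂ u∈w)) = ∈-∷ʳ⁺ˡ w u∈w

  singleton : Fin n → Clique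
  singleton a = ⁅ a ⁆ , λ u v u∈ v∈ u≢v →
    contradiction (trans (x∈⁅y⁆⇒x≡y a u∈) (sym (x∈⁅y⁆⇒x≡y a v∈))) u≢v

  ∈-singleton : ∀ a → a ∈ᶜ singleton a
  ∈-singleton = x∈⁅x⁆

  pair : ∀ {a b} → a ≡ b ⊎ Adj G a b → Clique
  pair {a} {b} a~b = ⁅ a ⁆ ∪ ⁅ b ⁆ , clique
    where
    split : ∀ {u} → u ∈ ⁅ a ⁆ ∪ ⁅ b ⁆ → u ≡ a ⊎ u ≡ b
    split = [ inj₁ ∘ x∈⁅y⁆⇒x≡y a , inj₂ ∘ x∈⁅y⁆⇒x≡y b ] ∘ x∈p∪q⁻ ⁅ a ⁆ ⁅ b ⁆
    adjacent : ∀ {u v} → u ≡ a ⊎ u ≡ b → v ≡ a ⊎ v ≡ b → a ≡ b ⊎ Adj G a b → u ≢ v → Adj G u v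
    adjacent (inj₁ refl) (inj₁ refl) _          u≢v = contradiction refl u≢v
    adjacent (inj₂ refl) (inj₂ refl) _          u≢v = contradiction refl u≢v
    adjacent (inj₁ refl) (inj₂ refl) (inj₁ a≡b) u≢v = contradiction a≡b u≢v
    adjacent (inj₂ refl) (inj₁ refl) (inj₁ a≡b) u≢v = contradiction (sym a≡b) u≢v
    adjacent (inj₁ refl) (inj₂ refl) (inj₂ adj) u≢v = adj
    adjacent (inj₂ refl) (inj₁ refl) (inj₂ adj) u≢v = symm G adj
    clique : IsClique G (⁅ a ⁆ ∪ ⁅ b ⁆)
    clique u v u∈ v∈ = adjacent (split u∈) (split v∈) a~b

  ∈-pairˡ : ∀ {a b} (a~b : a ≡ b ⊎ Adj G a b) → a ∈ᶜ pair a~b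
  ∈-pairˡ {a} _ = x∈p∪q⁺ (inj₁ (x∈⁅x⁆ a))

  ∈-pairʳ : ∀ {a b} (a~b : a ≡ b ⊎ Adj G a b) → b ∈ᶜ pair a~b
  ∈-pairʳ {b = b} _ = x∈p∪q⁺ (inj₂ (x∈⁅x⁆ b))

  -- Each clique takes care of the inside of the corner and of one chosen end. The two differ for
  -- `hollow`, where only a single end can be covered.
  first second : ∀ {a b} → Corner a b → Clique
  first (triangle a~b)    = pair a~b
  first (fan K _ _)       = K
  first {a} hollow        = singleton a
  second (triangle a~b)   = pair a~b
  second (fan K _ _)      = K
  second {b = b} hollow   = singleton b

  ∈-first : ∀ {a b} (c : Corner a b) → a ∈ᶜ first c
  ∈-first (triangle a~b)  = ∈-pairˡ a~b
  ∈-first (fan K a∈K _)   = a∈K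
  ∈-first {a} hollow      = ∈-singleton a

  ∈-second : ∀ {a b} (c : Corner a b) → b ∈ᶜ second c
  ∈-second (triangle a~b)    = ∈-pairʳ a~b
  ∈-second (fan K _ b∈K)     = b∈K
  ∈-second {b = b} hollow    = ∈-singleton b

  face⊆first : ∀ {a b u} (c : Corner a b) → u ∈ᶠ c → u ∈ᶜ first c
  face⊆first (fan _ _ _) u∈K = u∈K

  face⊆second : ∀ {a b u} (c : Corner a b) → u ∈ᶠ c → u ∈ᶜ second c
  face⊆second (fan _ _ _) u∈K = u∈K

  pattern start p = inj₁ p
  pattern face  p = inj₂ (inj₁ p)
  pattern rest  p = inj₂ (inj₂ p)

  pattern 1st p = inj₁ p
  pattern 2nd p = inj₂ (inj₁ p)
  pattern 3rd p = inj₂ (inj₂ p)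

  cover-0 : ∀ {a} → Cover3 (_∈ʷ [] {a})
  cover-0 {a} = singleton a , singleton a , singleton a , λ where
    u refl → 1st (∈-singleton a)

  cover-1 : ∀ {a} (c : Corner a a) → Cover3 (_∈ʷ c ∷ [])
  cover-1 c = first c , first c , first c , λ where
    u (start refl) → 1st (∈-first c)
    u (face u∈)    → 1st (face⊆first c u∈)
    u (rest refl)  → 1st (∈-first c)

  cover-2 : ∀ {a b} (c : Corner a b) (d : Corner b a) → Cover3 (_∈ʷ c ∷ d ∷ [])
  cover-2 c d = first c , first d , first d , λ where
    u (start refl)        → 1st (∈-first c)
    u (face u∈)           → 1st (face⊆first c u∈)
    u (rest (start refl)) → 2nd (∈-first d)
    u (rest (face u∈))    → 2nd (face⊆first d u∈)
    u (rest (rest refl))  → 1st (∈-first c)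

  cover-3 : ∀ {a b c} (d : Corner a b) (e : Corner b c) (f : Corner c a) → Cover3 (_∈ʷ d ∷ e ∷ f ∷ [])
  cover-3 d e f = first d , first e , first f , λ where
    u (start refl)               → 1st (∈-first d)
    u (face u∈)                  → 1st (face⊆first d u∈)
    u (rest (start refl))        → 2nd (∈-first e)
    u (rest (face u∈))           → 2nd (face⊆first e u∈)
    u (rest (rest (start refl))) → 3rd (∈-first f)
    u (rest (rest (face u∈)))    → 3rd (face⊆first f u∈)
    u (rest (rest (rest refl)))  → 1st (∈-first d)

  data Solid {a b : Fin n} : Corner a b → Set where
    solid : ∀ c K → (∀ {u} → u ∈ᶠ c → u ∈ᶜ K) → a ∈ᶜ K → b ∈ᶜ K → Solid c

  solid? : ∀ {a b} (c : Corner a b) → Solid c ⊎ c ≡ hollow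
  solid? (triangle a~b)    = inj₁ (solid _ (pair a~b) (λ ()) (∈-pairˡ a~b) (∈-pairʳ a~b))
  solid? (fan K a∈K b∈K)   = inj₁ (solid _ K id a∈K b∈K)
  solid? hollow            = inj₂ refl

  -- If both corners next to the triangle are solid, their cliques already contain all four nations
  -- of the walk, which leaves the third clique for the inside of `f`. If one of them is hollow, it
  -- has no inside, and the triangle together with the other two corners suffices.
  cover-4 : ∀ {a b c d} (t : a ≡ b ⊎ Adj G a b) (e : Corner b c) (f : Corner c d) (g : Corner d a) →
            Cover3 (_∈ʷ triangle t ∷ e ∷ f ∷ g ∷ [])
  cover-4 t e f g with solid? e | solid? g
  ... | inj₁ (solid e E e⊆E b∈E c∈E) | inj₁ (solid g G′ g⊆G d∈G a∈G) = E , first f , G′ , λ where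
    u (start refl)                      → 3rd a∈G
    u (rest (start refl))               → 1st b∈E
    u (rest (face u∈))                  → 1st (e⊆E u∈)
    u (rest (rest (start refl)))        → 1st c∈E
    u (rest (rest (face u∈)))           → 2nd (face⊆first f u∈)
    u (rest (rest (rest (start refl)))) → 3rd d∈G
    u (rest (rest (rest (face u∈))))    → 3rd (g⊆G u∈)
    u (rest (rest (rest (rest refl))))  → 3rd a∈G
  ... | inj₂ refl | _ = pair t , first f , first g , λ where
    u (start refl)                      → 1st (∈-pairˡ t)
    u (rest (start refl))               → 1st (∈-pairʳ t)
    u (rest (rest (start refl)))        → 2nd (∈-first f)
    u (rest (rest (face u∈)))           → 2nd (face⊆first f u∈)
    u (rest (rest (rest (start refl)))) → 3rd (∈-first g)
    u (rest (rest (rest (face u∈))))    → 3rd (face⊆first g u∈)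
    u (rest (rest (rest (rest refl))))  → 1st (∈-pairˡ t)
  ... | inj₁ _ | inj₂ refl = pair t , second e , second f , λ where
    u (start refl)                      → 1st (∈-pairˡ t)
    u (rest (start refl))               → 1st (∈-pairʳ t)
    u (rest (face u∈))                  → 2nd (face⊆second e u∈)
    u (rest (rest (start refl)))        → 2nd (∈-second e)
    u (rest (rest (face u∈)))           → 3rd (face⊆second f u∈)
    u (rest (rest (rest (start refl)))) → 3rd (∈-second f)
    u (rest (rest (rest (rest refl))))  → 1st (∈-pairˡ t)

  -- Every second triangle suffices: the other two have no vertices besides their ends.
  cover-5 : ∀ {a b c d e} (f : Corner a b) (t₁ : b ≡ c ⊎ Adj G b c) (t₂ : c ≡ d ⊎ Adj G c d)
            (t₃ : d ≡ e ⊎ Adj G d e) (t₄ : e ≡ a ⊎ Adj G e a) →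
            Cover3 (_∈ʷ f ∷ triangle t₁ ∷ triangle t₂ ∷ triangle t₃ ∷ triangle t₄ ∷ [])
  cover-5 f t₁ t₂ t₃ t₄ = first f , pair t₁ , pair t₃ , λ where
    u (start refl)                             → 1st (∈-first f)
    u (face u∈)                                → 1st (face⊆first f u∈)
    u (rest (start refl))                      → 2nd (∈-pairˡ t₁)
    u (rest (rest (start refl)))               → 2nd (∈-pairʳ t₁)
    u (rest (rest (rest (start refl))))        → 3rd (∈-pairˡ t₃)
    u (rest (rest (rest (rest (start refl))))) → 3rd (∈-pairʳ t₃)
    u (rest (rest (rest (rest (rest refl)))))  → 1st (∈-first f)

  data Triangle {a b : Fin n} : Corner a b → Set where
    triangle : (t : a ≡ b ⊎ Adj G a b) → Triangle (triangle t)

  triangle? : ∀ {a b} (c : Corner a b) → Triangle c ⊎ price c ≡ 3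
  triangle? (triangle t) = inj₁ (triangle t)
  triangle? (fan _ _ _)  = inj₂ refl
  triangle? hollow       = inj₂ refl

  2≤price : ∀ {a b} (c : Corner a b) → 2 ≤ price c
  2≤price (triangle _) = ≤-refl
  2≤price (fan _ _ _)  = n≤1+n 2
  2≤price hollow       = n≤1+n 2

  length : ∀ {a b} → Walk a b → ℕ
  length []      = 0
  length (_ ∷ w) = 1 + length w

  data Triangles {a : Fin n} : ∀ {b} → Walk a b → Set where
    []  : Triangles []
    _∷_ : ∀ {b c} {d : Corner a b} {w : Walk b c} → Triangle d → Triangles w → Triangles (d ∷ w)

  length*2≤cost : ∀ {a b} (w : Walk a b) → length w * 2 ≤ cost w
  length*2≤cost []      = z≤n
  length*2≤cost (c ∷ w) = +-mono-≤ (2≤price c) (length*2≤cost w)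

  -- Every corner costs at least 2, so this budget leaves no room for a price of 3.
  triangles : ∀ {a b} (w : Walk a b) → cost w ≤ length w * 2 → Triangles w
  triangles []      _ = []
  triangles (c ∷ w) cost≤ with triangle? c
  ... | inj₁ t = t ∷ triangles w (+-cancelˡ-≤ 2 _ _ (≤-trans (+-monoˡ-≤ _ (2≤price c)) cost≤))
  ... | inj₂ eq = contradiction (≤-trans (+-monoˡ-≤ _ (≤-reflexive (sym eq))) cost≤)
                                (<⇒≱ (+-monoʳ-≤ 3 (length*2≤cost w)))

  cost-∷ʳ : ∀ {a b c} (w : Walk a b) (d : Corner b c) → cost (w ∷ʳ d) ≡ price d + cost w
  cost-∷ʳ []      d = refl
  cost-∷ʳ (c ∷ w) d = begin
    price c + cost (w ∷ʳ d)      ≡⟨ cong (price c +_) (cost-∷ʳ w d) ⟩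
    price c + (price d + cost w) ≡⟨ +-assoc (price c) (price d) (cost w) ⟨
    price c + price d + cost w   ≡⟨ cong (_+ cost w) (+-comm (price c) (price d)) ⟩
    price d + price c + cost w   ≡⟨ +-assoc (price d) (price c) (cost w) ⟩
    price d + (price c + cost w) ∎
    where open ≡-Reasoning

  cheap-rotate : ∀ {a b} (c : Corner a b) (w : Walk b a) → cost (c ∷ w) < 12 → cost (w ∷ʳ c) < 12
  cheap-rotate c w = ≤-trans (s≤s (≤-reflexive (cost-∷ʳ w c)))

  -- A first corner of price 3 leaves at most 8 for the other four, which forces all of them to be
  -- triangles.
  cover-5-dear : ∀ {a b c d e} (f : Corner a b) (g : Corner b c) (h : Corner c d)
                 (i : Corner d e) (j : Corner e a) → price f ≡ 3 →
                 cost (f ∷ g ∷ h ∷ i ∷ j ∷ []) < 12 → Cover3 (_∈ʷ f ∷ g ∷ h ∷ i ∷ j ∷ [])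
  cover-5-dear f g h i j f-dear cheap
    with triangles (g ∷ h ∷ i ∷ j ∷ [])
           (+-cancelˡ-≤ 3 _ _ (≤-trans (+-monoˡ-≤ _ (≤-reflexive (sym f-dear))) (s≤s⁻¹ cheap)))
  ... | triangle t₁ ∷ triangle t₂ ∷ triangle t₃ ∷ triangle t₄ ∷ [] = cover-5 f t₁ t₂ t₃ t₄

  cover : ∀ {a} (w : Walk a a) → cost w < 12 → Cover3 (_∈ʷ w)
  cover []                     _ = cover-0
  cover (c ∷ [])               _ = cover-1 c
  cover (c ∷ d ∷ [])           _ = cover-2 c d
  cover (c ∷ d ∷ e ∷ [])       _ = cover-3 c d e
  cover (c ∷ d ∷ e ∷ f ∷ [])   cheap with triangle? c | triangle? d | triangle? e | triangle? f
  ... | inj₁ (triangle t) | _ | _ | _ = cover-4 t d e f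
  ... | inj₂ _ | inj₁ (triangle t) | _ | _ = rotate c (d ∷ e ∷ f ∷ []) (cover-4 t e f c)
  ... | inj₂ _ | inj₂ _ | inj₁ (triangle t) | _ =
    rotate c (d ∷ e ∷ f ∷ []) (rotate d (e ∷ f ∷ c ∷ []) (cover-4 t f c d))
  ... | inj₂ _ | inj₂ _ | inj₂ _ | inj₁ (triangle t) =
    rotate c (d ∷ e ∷ f ∷ []) (rotate d (e ∷ f ∷ c ∷ []) (rotate e (f ∷ c ∷ d ∷ []) (cover-4 t c d e)))
  -- Four corners of price 3 would cost exactly 12.
  ... | inj₂ c₃ | inj₂ d₃ | inj₂ e₃ | inj₂ f₃ =
    contradiction (cong₂ _+_ c₃ (cong₂ _+_ d₃ (cong₂ _+_ e₃ (cong (_+ 0) f₃)))) (<⇒≢ cheap)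
  cover (c ∷ d ∷ e ∷ f ∷ g ∷ []) cheap
    with triangle? c | triangle? d | triangle? e | triangle? f
  ... | inj₂ c₃ | _ | _ | _ = cover-5-dear c d e f g c₃ cheap
  ... | inj₁ _  | inj₂ d₃ | _ | _ =
    rotate c _ (cover-5-dear d e f g c d₃ (cheap-rotate c (d ∷ e ∷ f ∷ g ∷ []) cheap))
  ... | inj₁ _  | inj₁ _ | inj₂ e₃ | _ =
    rotate c _ (rotate d _ (cover-5-dear e f g c d e₃
      (cheap-rotate d (e ∷ f ∷ g ∷ c ∷ []) (cheap-rotate c (d ∷ e ∷ f ∷ g ∷ []) cheap))))
  ... | inj₁ _  | inj₁ _ | inj₁ _ | inj₂ f₃ =
    rotate c _ (rotate d _ (rotate e _ (cover-5-dear f g c d e f₃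
      (cheap-rotate e (f ∷ g ∷ c ∷ d ∷ []) (cheap-rotate d (e ∷ f ∷ g ∷ c ∷ [])
        (cheap-rotate c (d ∷ e ∷ f ∷ g ∷ []) cheap))))))
  -- The first four are triangles, so the fifth may be anything and is rotated to the front.
  ... | inj₁ (triangle t₁) | inj₁ (triangle t₂) | inj₁ (triangle t₃) | inj₁ (triangle t₄) =
    rotate c (d ∷ e ∷ f ∷ g ∷ []) (rotate d (e ∷ f ∷ g ∷ c ∷ []) (rotate e (f ∷ g ∷ c ∷ d ∷ []) (
      rotate f (g ∷ c ∷ d ∷ e ∷ []) (cover-5 g t₁ t₂ t₃ t₄))))
  -- Six corners cost at least 12 already.
  cover w@(_ ∷ _ ∷ _ ∷ _ ∷ _ ∷ _ ∷ w′) cheap =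
    contradiction cheap (≤⇒≯ (≤-trans (m≤m+n 12 _) (length*2≤cost w)))

-- The bipartite plane graph

module _ {n m : ℕ} (H : Graph (Fin n ⊎ Fin m)) (bipartite : IsBipartite H)
         (M : CombinatorialMap) (R : Represents M H) where

  open CombinatorialMap M
  open Represents R

  s a : Dart → Dart
  s d = σ ⟨$⟩ʳ d
  a d = α ⟨$⟩ʳ d

  s-injective : Injective _≡_ _≡_ s
  s-injective eq = trans (sym (inverseˡ σ)) (trans (cong (σ ⟨$⟩ˡ_) eq) (inverseˡ σ))

  a-injective : Injective _≡_ _≡_ a
  a-injective eq = trans (sym (α-involutive _)) (trans (cong a eq) (α-involutive _))

  tail-s : ∀ d → tail (s d) ≡ tail d
  tail-s d = sym (from (rotation d (s d)) (fwd refl ◅ ε))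

  tail-iterate : ∀ d k → tail (iterate s d k) ≡ tail d
  tail-iterate d zero    = refl
  tail-iterate d (suc k) = trans (tail-iterate (s d) k) (tail-s d)

  reaches : ∀ {d e} → tail d ≡ tail e → ∃[ k ] iterate s d k ≡ e
  reaches eq = closure⇒iterate s-injective (to (rotation _ _) eq)

  IsX IsY : Dart → Set
  IsX d = ∃[ x ] tail d ≡ inj₁ x
  IsY d = ∃[ y ] tail d ≡ inj₂ y

  side : ∀ d → IsX d ⊎ IsY d
  side d with tail d
  ... | inj₁ x = inj₁ (x , refl)
  ... | inj₂ y = inj₂ (y , refl)

  edge : ∀ d → Adj H (tail d) (head d)
  edge d = from (edges _ _) (d , refl , refl)

  X⇒Y : ∀ {d} → IsX d → IsY (a d)
  X⇒Y {d} (x , x≡) with side (a d)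
  ... | inj₂ Y = Y
  ... | inj₁ (x′ , x′≡) = contradiction (subst₂ (Adj H) x≡ x′≡ (edge d)) (proj₁ bipartite x x′)

  Y⇒X : ∀ {d} → IsY d → IsX (a d)
  Y⇒X {d} (y , y≡) with side (a d)
  ... | inj₁ X = X
  ... | inj₂ (y′ , y′≡) = contradiction (subst₂ (Adj H) y≡ y′≡ (edge d)) (proj₂ bipartite y y′)

  -- An X-dart is lone if it leads to a leaf of H.
  Lone Inner : Dart → Set
  Lone d  = s (a d) ≡ a d
  Inner d = ¬ Lone d

  inner? : ∀ d → Dec (Inner d)
  inner? d = ¬? (s (a d) ≟ a d)

  open FirstReturn s-injective inner?

  -- On X-darts, τ rotates around the head and ρ around the tail, and ψ walks around a face;
  -- ρ and ψ skip the leaves of H.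
  τ ρ ψ : Dart → Dart
  τ d = a (s (a d))
  ρ   = return
  ψ   = ρ ∘ τ

  τ⁻¹ : Dart → Dart
  τ⁻¹ d = a (σ ⟨$⟩ˡ a d)

  τ-τ⁻¹ : ∀ d → τ (τ⁻¹ d) ≡ d
  τ-τ⁻¹ d = begin
    a (s (a (a (σ ⟨$⟩ˡ a d)))) ≡⟨ cong (a ∘ s) (α-involutive _) ⟩
    a (s (σ ⟨$⟩ˡ a d))         ≡⟨ cong a (inverseʳ σ) ⟩
    a (a d)                    ≡⟨ α-involutive d ⟩
    d                          ∎
    where open ≡-Reasoning

  ρ-injective : Injective _≡_ _≡_ ρ
  ρ-injective = return-injective

  ψ-injective : Injective _≡_ _≡_ ψ
  ψ-injective eq = a-injective (s-injective (a-injective (ρ-injective eq)))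

  tail-next : ∀ {d e} → Next d e → tail e ≡ tail d
  tail-next (stop _)      = tail-s _
  tail-next (skip _ next) = trans (tail-next next) (tail-s _)

  tail-ρ : ∀ d → tail (ρ d) ≡ tail d
  tail-ρ d with inner? d
  ... | yes p = tail-next (return-next p)
  ... | no ¬p = cong tail (return-fixed ¬p)

  head-τ : ∀ d → head (τ d) ≡ head d
  head-τ d = trans (cong tail (α-involutive _)) (tail-s (a d))

  inner-τ : ∀ {d} → Inner d → Inner (τ d)
  inner-τ {d} d-inner lone = d-inner (s-injective
    (trans (cong s (sym (α-involutive _))) (trans lone (α-involutive _))))

  inner-ρ : ∀ {d} → Inner d → Inner (ρ d)
  inner-ρ d-inner = Next-P (return-next d-inner)

  X-ρ : ∀ {d} → IsX d → IsX (ρ d)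
  X-ρ (x , x≡) = x , trans (tail-ρ _) x≡

  X-τ : ∀ {d} → IsX d → IsX (τ d)
  X-τ d-X with y , y≡ ← X⇒Y d-X = Y⇒X (y , trans (tail-s _) y≡)

  head-τ⁻¹ : ∀ d → head (τ⁻¹ d) ≡ head d
  head-τ⁻¹ d = trans (sym (head-τ (τ⁻¹ d))) (cong head (τ-τ⁻¹ d))

  inner-τ⁻¹ : ∀ {d} → Inner d → Inner (τ⁻¹ d)
  inner-τ⁻¹ {d} d-inner lone = d-inner (subst Lone
    (trans (sym (trans (cong a lone) (α-involutive _))) (τ-τ⁻¹ d)) lone)

  X-τ⁻¹ : ∀ {d} → IsX d → IsX (τ⁻¹ d)
  X-τ⁻¹ {d} d-X with y , y≡ ← X⇒Y d-X =
    Y⇒X (y , trans (sym (tail-s _)) (trans (cong tail (inverseʳ σ)) y≡))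

  -- Since `ρ` keeps tails and `τ` keeps heads, a fixed point would make `τ d` parallel to `d`. As
  -- `H` is simple, they would be equal and `d` would lead to a leaf.
  ψ-fixfree : ∀ {d} → Inner d → ψ d ≢ d
  ψ-fixfree {d} d-inner ψd≡d = d-inner (a-injective (trans τd≡d (sym (α-involutive d))))
    where
    τd≡d : τ d ≡ d
    τd≡d = simple (τ d) d (trans (sym (tail-ρ (τ d))) (cong tail ψd≡d)) (head-τ d)

  ψ-lone : ∀ {d} → Lone d → ψ d ≡ d
  ψ-lone {d} lone = trans (cong (ρ ∘ a) lone) (trans (cong ρ (α-involutive d)) (return-fixed (λ p → p lone)))

  -- The costs 12 (1/2 - 1/|f|) of the vertex of Y and of the face next to an X-dart.
  costY costF dartCost : Dart → ℕ
  costY d    = 6 ∸ weight s (a d)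
  costF d    = 6 ∸ weight ψ d
  dartCost d = costF d + costY d

  dartCost-lone : ∀ {d} → Lone d → dartCost d ≡ 0
  -- Both weights are 12, and the truncated difference `6 ∸ 12` is 0.
  dartCost-lone {d} lone rewrite weight-1 s (a d) lone | weight-1 ψ d (ψ-lone lone) = refl

  _≟ᵛ_ : (u v : Fin n ⊎ Fin m) → Dec (u ≡ v)
  _≟ᵛ_ = ≡-dec _≟_ _≟_

  vertexCost : Fin n → ℕ
  vertexCost x = sum (λ d → dartCost d when tail d ≟ᵛ inj₁ x)

  inner-at : ∀ {x} → 0 < vertexCost x → ∃[ d ] tail d ≡ inj₁ x × Inner d
  inner-at {x} cost>0 with any? (λ d → (tail d ≟ᵛ inj₁ x) ×-dec inner? d)
  ... | yes found = found
  ... | no ¬found = contradiction (sum-zero (λ d → dartCost d when tail d ≟ᵛ inj₁ x) zeros) (>⇒≢ cost>0)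
    where
    zeros : ∀ d → (dartCost d when tail d ≟ᵛ inj₁ x) ≡ 0
    zeros d with tail d ≟ᵛ inj₁ x
    ... | no _ = refl
    ... | yes d∈x = dartCost-lone (decidable-stable (s (a d) ≟ a d) (λ d-inner → ¬found (d , d∈x , d-inner)))

  -- Discharging: if every nation is dear, Euler's formula fails

  module _ (dear : ∀ x → 12 ≤ vertexCost x) where

    -- Every vertex and every face of H receives at least 12, while every edge pays exactly 12.
    chargeV′ chargeF′ : Fin n ⊎ Fin m → Dart → ℕ
    chargeV′ (inj₁ _) d = dartCost d
    chargeV′ (inj₂ _) d = weight s d
    chargeF′ (inj₁ _) d = weight ψ d when inner? d
    chargeF′ (inj₂ _) d = 0

    chargeV chargeF charge : Dart → ℕ
    chargeV d = chargeV′ (tail d) d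
    chargeF d = chargeF′ (tail d) d
    charge d  = chargeV d + chargeF d

    edge-charge : ∀ {d} → IsX d → charge d + charge (a d) ≡ 12
    edge-charge {d} (x , x≡) with y , y≡ ← X⇒Y (x , x≡) =
      trans (cong₂ _+_ (cong (λ v → chargeV′ v d + chargeF′ v d) x≡)
                       (cong (λ v → chargeV′ v (a d) + chargeF′ v (a d)) y≡))
            (balance (s (a d) ≟ a d))
      where
      rearrange : ∀ {p p′ q q′} → p + p′ ≡ 6 → q + q′ ≡ 6 → p + q + p′ + q′ ≡ 12
      rearrange {p} {p′} {q} {q′} p+p′ q+q′ = begin
        p + q + p′ + q′   ≡⟨ cong (_+ q′) (+-assoc p q p′) ⟩
        p + (q + p′) + q′ ≡⟨ cong (λ z → p + z + q′) (+-comm q p′) ⟩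
        p + (p′ + q) + q′ ≡⟨ cong (_+ q′) (+-assoc p p′ q) ⟨
        p + p′ + q + q′   ≡⟨ +-assoc (p + p′) q q′ ⟩
        p + p′ + (q + q′) ≡⟨ cong₂ _+_ p+p′ q+q′ ⟩
        12                ∎
        where open ≡-Reasoning
      balance : Dec (Lone d) → dartCost d + (weight ψ d when inner? d) + (weight s (a d) + 0) ≡ 12
      -- The edge to a leaf gives its whole charge of 12 to the leaf.
      balance (yes lone) = cong₂ _+_
        (cong₂ _+_ (dartCost-lone lone) (when-no (inner? d) (λ d-inner → d-inner lone)))
        (cong (_+ 0) (weight-1 s (a d) lone))
      -- For an inner dart both weights are at most 6, so no truncation occurs and each cost adds up
      -- with its weight to 6.
      balance (no d-inner) = trans
        (cong₂ _+_ (cong (dartCost d +_) (when-yes (inner? d) d-inner)) (+-identityʳ _))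
        (rearrange {costF d} {weight ψ d} {costY d} (m∸n+n≡m (weight≤6 ψ d (ψ-fixfree d-inner)))
                   (m∸n+n≡m (weight≤6 s (a d) d-inner)))

    edge-charge′ : ∀ d → charge d + charge (a d) ≡ 12
    edge-charge′ d with side d
    ... | inj₁ d-X = edge-charge d-X
    ... | inj₂ d-Y = begin
      charge d + charge (a d)         ≡⟨ +-comm (charge d) _ ⟩
      charge (a d) + charge d         ≡⟨ cong (λ e → charge (a d) + charge e) (α-involutive d) ⟨
      charge (a d) + charge (a (a d)) ≡⟨ edge-charge (Y⇒X d-Y) ⟩
      12                              ∎
      where open ≡-Reasoning

    α-orbit : ∀ {d e} → EqClosure (Step α) d e → e ≡ d ⊎ e ≡ a d
    α-orbit ε = inj₁ refl
    α-orbit (step ◅ path) with step | α-orbit path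
    ... | fwd refl | inj₁ refl = inj₂ refl
    ... | fwd refl | inj₂ refl = inj₁ (α-involutive _)
    ... | bwd refl | inj₁ refl = inj₂ (sym (α-involutive _))
    ... | bwd refl | inj₂ refl = inj₁ refl

    edges-total : ∀ {e} → HasClasses (Step α) e → sum charge ≤ e * 12
    edges-total (class , onto , class⇔) = sum≤classes* class charge bound
      where
      bound : ∀ j → sum (λ d → charge d when class d ≟ j) ≤ 12
      bound j with i , i∈ ← onto j = begin
        sum (λ d → charge d when class d ≟ j)                              ≤⟨ sum-mono-≤ pointwise ⟩
        sum (λ d → (charge d when i ≟ d) + (charge d when a i ≟ d))
          ≡⟨ ∑-distrib-+ (λ d → charge d when i ≟ d) (λ d → charge d when a i ≟ d) ⟩
        sum (λ d → charge d when i ≟ d) + sum (λ d → charge d when a i ≟ d)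
          ≡⟨ cong₂ _+_ (sum-when charge i) (sum-when charge (a i)) ⟩
        charge i + charge (a i)                                            ≡⟨ edge-charge′ i ⟩
        12                                                                 ∎
        where
        open ≤-Reasoning
        pointwise : ∀ d → (charge d when class d ≟ j) ≤ (charge d when i ≟ d) + (charge d when a i ≟ d)
        pointwise d with class d ≟ j
        ... | no _ = z≤n
        ... | yes d∈ with α-orbit (to (class⇔ i d) (trans (i∈ refl) (sym d∈)))
        ...   | inj₁ refl = ≤-trans (≤-reflexive (sym (when-yes (i ≟ i) refl))) (m≤m+n _ _)
        ...   | inj₂ refl = ≤-trans (≤-reflexive (sym (when-yes (a i ≟ a i) refl))) (m≤n+m _ _)

    -- At a nation the bound is `dear`; the darts at a vertex of `Y` form one orbit of `s`, whose
    -- weights add up to at least 12.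
    vertices-total : ∀ {v} → HasClasses (Step σ) v → v * 12 ≤ sum chargeV
    vertices-total (class , onto , class⇔) = classes*≤sum class chargeV bound
      where
      bound : ∀ j → 12 ≤ sum (λ d → chargeV d when class d ≟ j)
      bound j with i , i∈ ← onto j | side i
      ... | inj₁ (x , x≡) = ≤-trans (dear x) (sum-mono-≤ pointwise)
        where
        pointwise : ∀ d → (dartCost d when tail d ≟ᵛ inj₁ x) ≤ (chargeV d when class d ≟ j)
        pointwise d with tail d ≟ᵛ inj₁ x
        ... | no _ = z≤n
        ... | yes d∈x rewrite d∈x = ≤-reflexive (sym (when-yes (class d ≟ j) d∈j))
          where
          d∈j : class d ≡ j
          d∈j = trans (from (class⇔ d i) (to (rotation d i) (trans d∈x (sym x≡)))) (i∈ refl)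
      ... | inj₂ (y , y≡) = 12≤orbit-sum s-injective _ i onOrbit
        where
        onOrbit : ∀ k → (chargeV (iterate s i k) when class (iterate s i k) ≟ j) ≡ weight s (iterate s i k)
        onOrbit k rewrite trans (tail-iterate i k) y≡ = when-yes (class (iterate s i k) ≟ j)
          (trans (from (class⇔ _ i) (to (rotation _ i) (tail-iterate i k))) (i∈ refl))

    infix 4 _≈_
    _≈_ : Dart → Dart → Set
    _≈_ = EqClosure (Step φ)

    φ-step : ∀ d → d ≈ φ ⟨$⟩ʳ d
    φ-step d = fwd refl ◅ ε

    -- A face walk goes out to the leaf and straight back, so passing a leaf stays in the face.
    ≈-lone : ∀ {d} → Lone d → d ≈ s d
    ≈-lone {d} lone = φ-step d ◅◅ fwd (trans (cong (s ∘ a) lone) (cong s (α-involutive d))) ◅ ε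

    ≈-next : ∀ {d e} → Next d e → s d ≈ e
    ≈-next (stop _)       = ε
    ≈-next {d} (skip ¬inner next) =
      ≈-lone (decidable-stable (s (a (s d)) ≟ a (s d)) ¬inner) ◅◅ ≈-next next

    -- Two steps of `φ` lead from `d` to `s (τ d)`, and from there only leaves are passed.
    ≈-ψ : ∀ {d} → Inner d → d ≈ ψ d
    ≈-ψ {d} d-inner = φ-step d ◅◅ φ-step (s (a d)) ◅◅ ≈-next (return-next (inner-τ d-inner))

    -- A nation with only lone darts would have cost 0, so a dear one has an inner dart. Rotating
    -- from a lone `d` past leaves to the first inner dart does not leave the face.
    face-inner-X : ∀ {d} → IsX d → ∃[ e ] d ≈ e × IsX e × Inner e
    face-inner-X {d} (x , x≡) with s (a d) ≟ a d
    ... | no d-inner = d , ε , (x , x≡) , d-inner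
    ... | yes lone
      with e , e≡ , e-inner ← inner-at (≤-trans (s≤s z≤n) (dear x))
      with k , reach ← reaches (trans (tail-s d) (trans x≡ (sym e≡)))
      with e′ , next ← next-before d k (subst Inner (sym reach) e-inner) =
      e′ , ≈-lone lone ◅◅ ≈-next next , (x , trans (tail-next next) x≡) , Next-P next

    φ-X : ∀ {d} → IsY d → IsX (φ ⟨$⟩ʳ d)
    φ-X d-Y with x , x≡ ← Y⇒X d-Y = x , trans (tail-s _) x≡

    face-inner : ∀ d → ∃[ e ] d ≈ e × IsX e × Inner e
    face-inner d with side d
    ... | inj₁ d-X = face-inner-X d-X
    ... | inj₂ d-Y with e , path , e-XI ← face-inner-X (φ-X d-Y) = e , φ-step d ◅◅ path , e-XI

    ψ-iterate : ∀ {d} → IsX d → Inner d → ∀ k →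
                d ≈ iterate ψ d k × IsX (iterate ψ d k) × Inner (iterate ψ d k)
    ψ-iterate d-X d-inner zero    = ε , d-X , d-inner
    ψ-iterate d-X d-inner (suc k)
      with path , X , inner ← ψ-iterate (X-ρ (X-τ d-X)) (inner-ρ (inner-τ d-inner)) k =
      ≈-ψ d-inner ◅◅ path , X , inner

    -- For a lower bound it is enough to find one orbit of `ψ` within each face.
    faces-total : ∀ {f} → HasClasses (Step φ) f → f * 12 ≤ sum chargeF
    faces-total (class , onto , class⇔) = classes*≤sum class chargeF bound
      where
      bound : ∀ j → 12 ≤ sum (λ d → chargeF d when class d ≟ j)
      bound j with i , i∈ ← onto j with d , path , d-X , d-inner ← face-inner i =
        12≤orbit-sum ψ-injective _ d onOrbit
        where
        onOrbit : ∀ k → (chargeF (iterate ψ d k) when class (iterate ψ d k) ≟ j) ≡ weight ψ (iterate ψ d k)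
        onOrbit k with path′ , (x , x≡) , inner ← ψ-iterate d-X d-inner k
          rewrite x≡ | when-yes {c = weight ψ (iterate ψ d k)} (inner? (iterate ψ d k)) inner =
          when-yes (class (iterate ψ d k) ≟ j)
            (trans (sym (from (class⇔ i _) (path ◅◅ path′))) (i∈ refl))

    not-spherical : Fin n → ¬ IsSpherical M
    -- With no components there are no darts, but a dear nation has one.
    not-spherical x (v , e , f , zero , V , E , F , (class , _) , euler) =
      ¬Fin0 (class (proj₁ (inner-at (≤-trans (s≤s z≤n) (dear x)))))
    not-spherical x (v , e , f , suc c , V , E , F , _ , euler) = <⇒≱ too-many (≤-reflexive (sym euler))
      where
      open ≤-Reasoning
      bounds : (v + f) * 12 ≤ e * 12
      bounds = begin
        (v + f) * 12                  ≡⟨ *-distribʳ-+ 12 v f ⟩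
        v * 12 + f * 12               ≤⟨ +-mono-≤ (vertices-total V) (faces-total F) ⟩
        sum chargeV + sum chargeF     ≡⟨ ∑-distrib-+ chargeV chargeF ⟨
        sum charge                    ≤⟨ edges-total E ⟩
        e * 12                        ∎
      too-many : v + f < e + 2 * suc c
      too-many = ≤-<-trans (*-cancelʳ-≤ (v + f) e 12 bounds) (m<m+n e (s≤s z≤n))

  -- The closed walk through the neighbours of a nation

  module _ (G : Graph (Fin n))
           (G-spec : ∀ u v → Adj G u v ⇔
             (u ≢ v × ∃[ y ] Adj H (inj₁ u) (inj₂ y) × Adj H (inj₁ v) (inj₂ y)))
           (x : Fin n) where

    open Cliques G

    -- Only meaningful on X-darts; elsewhere the value is x.
    nation : Dart → Fin n
    nation d = [ id , const x ]′ (tail d)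

    tail-nation : ∀ {d} → IsX d → tail d ≡ inj₁ (nation d)
    tail-nation (u , u≡) rewrite u≡ = refl

    nation-cong : ∀ {d e} → tail d ≡ tail e → nation d ≡ nation e
    nation-cong = cong [ id , const x ]′

    same-head : ∀ {d e} → IsX d → IsX e → head d ≡ head e →
                nation d ≡ nation e ⊎ Adj G (nation d) (nation e)
    same-head {d} {e} d-X e-X heads with nation d ≟ nation e | X⇒Y d-X
    ... | yes eq | _       = inj₁ eq
    ... | no neq | y , y≡ = inj₂ (from (G-spec _ _)
      (neq , y , subst₂ (Adj H) (tail-nation d-X) y≡ (edge d)
               , subst₂ (Adj H) (tail-nation e-X) (trans (sym heads) y≡) (edge e)))

    -- The walk may also stay unchanged: a digon costs 0 and adds no corner, because its ends
    -- coincide.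
    Extension : ∀ {b c} → Walk b c → Fin n → ℕ → Set
    Extension {c = c} w a price = ∃[ w′ ] cost {a} {c} w′ ≡ price + cost w ×
                                  (∀ {u} → u ∈ʷ w → u ∈ʷ w′)

    widen : ∀ {a b c} (d : Corner a b) (w : Walk b c) → Extension w a (price d)
    widen d w = d ∷ w , refl , inj₂ ∘ inj₂

    stay : ∀ {a b c} → a ≡ b → (w : Walk b c) → Extension w a 0
    stay refl w = w , refl , id

    -- The face passes `nation p`, `nation q` and `nation (τ q)` in turn. In a digon the outer two
    -- are equal; in a triangle the third step of `ψ` makes them share a vertex of `Y`.
    face-corner : ∀ {p q b} → ψ p ≡ q → IsX p → Inner p → (w : Walk (nation (τ q)) b) →
                  Extension w (nation p) (costF q)
    face-corner {p} refl p-X p-inner w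
      with weight ψ (ψ p) | longPeriod ψ (ψ p) (ψ-fixfree (inner-ρ (inner-τ p-inner)))
    ... | _ | two period refl   = stay (nation-cong tail-p) w
      where
      tail-p : tail p ≡ tail (τ (ψ p))
      tail-p = trans (cong tail (sym (ψ-injective period))) (tail-ρ _)
    ... | _ | three period refl = widen (triangle adjacent) w
      where
      q-X : IsX (τ (ψ p))
      q-X = X-τ (X-ρ (X-τ p-X))
      tail-p : tail p ≡ tail (τ (ψ (ψ p)))
      tail-p = trans (cong tail (sym (ψ-injective period))) (tail-ρ _)
      adjacent : nation p ≡ nation (τ (ψ p)) ⊎ Adj G (nation p) (nation (τ (ψ p)))
      adjacent = subst₂ (λ u v → u ≡ v ⊎ Adj G u v) (nation-cong (sym tail-p)) (nation-cong (tail-ρ _))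
        (same-head (X-τ (X-ρ q-X)) (X-ρ q-X) (head-τ _))
    ... | _ | more refl         = widen hollow w

    -- The darts into the head of `d` are numbered from `τ d` at index 0 up to `d` itself at index
    -- `p`.
    same-head-iterate : ∀ {d e p} → Periodic s (a d) p → head e ≡ head d →
                        ∃[ q ] q < suc p × e ≡ a (iterate s (s (a d)) q)
    same-head-iterate {d} period heads
      with k , eq ← reaches (sym heads)
      with q , q<1+p , eq′ ← orbit-< s-injective (a d) period k =
      q , q<1+p , trans (sym (α-involutive _)) (cong a (trans (sym eq) eq′))

    σ-inverse : ∀ {d e} → s d ≡ e → d ≡ σ ⟨$⟩ˡ e
    σ-inverse refl = sym (inverseˡ σ)

    Sharing : ∀ {b c} → Walk b c → Dart → Set
    Sharing w d = ∀ {e} → IsX e → head e ≡ head d → tail e ≢ tail d → nation e ∈ʷ w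

    -- Around a vertex of `Y` of degree 2 or 3, the nations other than that of `d` are just `τ d`
    -- and `τ⁻¹ d`, the ends of the corner. For larger degree a `fan` is used, whose clique holds
    -- all nations around the vertex.
    vertex-corner : ∀ {d b} → IsX d → Inner d → (w : Walk (nation (τ⁻¹ d)) b) →
                    Σ[ w′ ∈ Extension w (nation (τ d)) (costY d) ] Sharing (proj₁ w′) d
    vertex-corner {d} d-X d-inner w
      with weight s (a d) | longPeriod s (a d) d-inner
    ... | _ | two period refl   = stay (nation-cong (cong tail τ≡τ⁻¹)) w , shared
      where
      τ≡τ⁻¹ : τ d ≡ τ⁻¹ d
      τ≡τ⁻¹ = cong a (σ-inverse period)
      shared : Sharing (proj₁ (stay (nation-cong (cong tail τ≡τ⁻¹)) w)) d
      shared e-X heads e≢ with same-head-iterate {p = 1} period heads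
      ... | 0 , _ , refl = source∈ (proj₁ (stay (nation-cong (cong tail τ≡τ⁻¹)) w))
      ... | 1 , _ , refl = contradiction (cong tail (trans (cong a period) (α-involutive d))) e≢
      ... | suc (suc _) , s≤s (s≤s ()) , _
    ... | _ | three period refl = widen (triangle adjacent) w , shared
      where
      τ²≡τ⁻¹ : τ (τ d) ≡ τ⁻¹ d
      τ²≡τ⁻¹ = trans (cong (a ∘ s) (α-involutive _)) (cong a (σ-inverse period))
      adjacent : nation (τ d) ≡ nation (τ⁻¹ d) ⊎ Adj G (nation (τ d)) (nation (τ⁻¹ d))
      adjacent = subst (λ e → nation (τ d) ≡ nation e ⊎ Adj G (nation (τ d)) (nation e)) τ²≡τ⁻¹
        (same-head (X-τ d-X) (X-τ (X-τ d-X)) (sym (head-τ (τ d))))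
      shared : Sharing (triangle adjacent ∷ w) d
      shared e-X heads e≢ with same-head-iterate {p = 2} period heads
      ... | 0 , _ , refl = inj₁ refl
      ... | 1 , _ , refl = inj₂ (inj₂ (subst (λ e → nation e ∈ʷ w)
                                             (sym (cong a (σ-inverse period))) (source∈ w)))
      ... | 2 , _ , refl = contradiction (cong tail (trans (cong a period) (α-involutive d))) e≢
      ... | suc (suc (suc _)) , s≤s (s≤s (s≤s ())) , _
    ... | _ | more refl =
      widen (fan nations (∈-nations (X-τ d-X) (head-τ d)) (∈-nations (X-τ⁻¹ d-X) (head-τ⁻¹ d))) w ,
      λ e-X heads _ → inj₂ (inj₁ (∈-nations e-X heads))
      where
      adjacent? : ∀ u → Dec (Adj H (inj₁ u) (head d))
      adjacent? u = adj? H (inj₁ u) (head d)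
      nations : Clique
      nations = tabulate (does ∘ adjacent?) , λ u v u∈ v∈ u≢v → case X⇒Y d-X of λ where
        (y , y≡) → from (G-spec u v) (u≢v , y ,
          subst (Adj H (inj₁ u)) y≡ (∈-tabulate⁻ adjacent? u∈) ,
          subst (Adj H (inj₁ v)) y≡ (∈-tabulate⁻ adjacent? v∈))
      ∈-nations : ∀ {e} → IsX e → head e ≡ head d → nation e ∈ᶜ nations
      ∈-nations {e} e-X heads = ∈-tabulate⁺ adjacent? (subst₂ (Adj H) (tail-nation e-X) heads (edge e))

    -- Each step of ρ passes the face between d and ρ d, and then the Y-vertex at ρ d.
    walk : ∀ {d} → IsX d → Inner d → ∀ k →
           Σ[ w ∈ Walk (nation (τ⁻¹ d)) (nation (τ⁻¹ (iterate ρ d k))) ]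
             cost w ≡ List.sum (map dartCost (applyUpTo (iterate ρ (ρ d)) k)) ×
             (∀ {i} → i < k → Sharing w (iterate ρ (ρ d) i))
    walk d-X d-inner zero = [] , refl , λ ()
    walk {d} d-X d-inner (suc k)
      with w , w-cost , w-shares ← walk (X-ρ d-X) (inner-ρ d-inner) k
      with (w₁ , w₁-cost , w⊆w₁) , w₁-shares ← vertex-corner (X-ρ d-X) (inner-ρ d-inner) w
      -- As `ψ (τ⁻¹ d)` is `ρ d`, this face lies between `nation (τ⁻¹ d)` and `nation (τ (ρ d))`,
      -- where `w₁` starts.
      with w₂ , w₂-cost , w₁⊆w₂ ← face-corner (cong ρ (τ-τ⁻¹ d)) (X-τ⁻¹ d-X) (inner-τ⁻¹ d-inner) w₁ =
      w₂ ,
      trans w₂-cost (trans (cong (costF (ρ d) +_) (trans w₁-cost (cong (costY (ρ d) +_) w-cost)))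
                           (sym (+-assoc (costF (ρ d)) (costY (ρ d)) _))) ,
      shares
      where
      shares : ∀ {i} → i < suc k → Sharing w₂ (iterate ρ (ρ d) i)
      shares {zero}  _         e-X heads e≢ = w₁⊆w₂ (w₁-shares e-X heads e≢)
      shares {suc i} (s≤s i<k) e-X heads e≢ = w₁⊆w₂ (w⊆w₁ (w-shares i<k e-X heads e≢))

    closed-walk : ∀ {d p} → IsX d → Inner d → Periodic ρ d p →
                  Σ[ w ∈ Walk (nation (τ⁻¹ d)) (nation (τ⁻¹ d)) ]
                    cost w ≡ List.sum (map dartCost (applyUpTo (iterate ρ (ρ d)) (suc p))) ×
                    (∀ {i} → i < suc p → Sharing w (iterate ρ (ρ d) i))
    closed-walk {d} {p} d-X d-inner period = subst
      (λ e → Σ[ w ∈ Walk (nation (τ⁻¹ d)) (nation (τ⁻¹ e)) ]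
               cost w ≡ List.sum (map dartCost (applyUpTo (iterate ρ (ρ d)) (suc p))) ×
               (∀ {i} → i < suc p → Sharing w (iterate ρ (ρ d) i)))
      period (walk d-X d-inner (suc p))

    tail-ρ-iterate : ∀ d k → tail (iterate ρ d k) ≡ tail d
    tail-ρ-iterate d zero    = refl
    tail-ρ-iterate d (suc k) = trans (tail-ρ-iterate (ρ d) k) (tail-ρ d)

    neighbour-darts : ∀ {u} → Adj G x u →
                      ∃[ d ] ∃[ e ] tail d ≡ inj₁ x × tail e ≡ inj₁ u × head e ≡ head d × tail e ≢ tail d
    neighbour-darts {u} x~u with x≢u , y , x~y , u~y ← to (G-spec x u) x~u
      with d , d-tail , d-head ← to (edges (inj₁ x) (inj₂ y)) x~y
      with e , e-tail , e-head ← to (edges (inj₁ u) (inj₂ y)) u~y =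
      d , e , d-tail , e-tail , trans e-head (sym d-head) ,
      λ eq → x≢u (inj₁-injective (trans (sym d-tail) (trans (sym eq) e-tail)))

    -- A leaf has a single dart, so it cannot be shared by two nations.
    shared⇒inner : ∀ {d e} → head e ≡ head d → tail e ≢ tail d → Inner d
    shared⇒inner {d} {e} heads e≢ lone with same-head-iterate {p = 0} lone heads
    ... | 0 , _ , refl = e≢ (cong tail (trans (cong a lone) (α-involutive d)))
    ... | suc _ , s≤s () , _

    -- The walk pays for each dart on the `ρ`-orbit of `d` once, all of them at `x`, so its cost is
    -- at most `vertexCost x`. A neighbour of `x` shares a vertex of `Y` with it; the dart from `x`
    -- to that vertex is inner, hence on this orbit.
    cover-around : ∀ {d} → tail d ≡ inj₁ x → Inner d → vertexCost x < 12 →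
                   Cover3 (_∈ neighbourhood G x)
    cover-around {d} d-tail d-inner cheap
      with p , period , distinct ← orbit-list ρ-injective d
      with w , w-cost , w-shares ← closed-walk {p = p} (x , d-tail) d-inner period =
      cover3-⊆ covered (cover w (≤-<-trans bound cheap))
      where
      dartCostAt : Dart → ℕ
      dartCostAt e = dartCost e when tail e ≟ᵛ inj₁ x
      at-x : ∀ k → dartCost (iterate ρ (ρ d) k) ≡ dartCostAt (iterate ρ (ρ d) k)
      at-x k = sym (when-yes (tail _ ≟ᵛ inj₁ x) (trans (tail-ρ-iterate d (suc k)) d-tail))
      bound : cost w ≤ vertexCost x
      bound = begin
        cost w                                                              ≡⟨ w-cost ⟩
        List.sum (map dartCost (applyUpTo (iterate ρ (ρ d)) (suc p)))
          ≡⟨ cong List.sum (map-cong-local (applyUpTo⁺₂ (iterate ρ (ρ d)) (suc p) at-x)) ⟩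
        List.sum (map dartCostAt (applyUpTo (iterate ρ (ρ d)) (suc p)))     ≤⟨ sum-unique dartCostAt distinct ⟩
        vertexCost x                                                        ∎
        where open ≤-Reasoning
      covered : ∀ u → u ∈ neighbourhood G x → u ∈ʷ w
      covered u u∈
        with e , e′ , e-tail , e′-tail , heads , e′≢ ← neighbour-darts (∈-tabulate⁻ (adj? G x) u∈)
        with k , refl ← reaches (trans d-tail (sym e-tail))
        with j , reach ← return-reaches k d-inner (shared⇒inner heads e′≢)
        with q , q<1+p , reach′ ← orbit-< ρ-injective d {p} period j =
        subst (λ v → v ∈ʷ w) (inj₁-injective (trans (sym (tail-nation (u , e′-tail))) e′-tail))
          (subst (Sharing w) (sym (trans reach reach′)) (w-shares q<1+p) (u , e′-tail) heads e′≢)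

    no-neighbours : (∀ d → tail d ≡ inj₁ x → ¬ Inner d) → Cover3 (_∈ neighbourhood G x)
    no-neighbours none = singleton x , singleton x , singleton x , λ u u∈ →
      case neighbour-darts (∈-tabulate⁻ (adj? G x) u∈) of λ where
        (d , e , d-tail , e-tail , heads , e≢) → contradiction (shared⇒inner heads e≢) (none d d-tail)

    cheap-cover : vertexCost x < 12 → Cover3 (_∈ neighbourhood G x)
    cheap-cover cheap with any? (λ d → (tail d ≟ᵛ inj₁ x) ×-dec inner? d)
    ... | yes (d , d-tail , d-inner) = cover-around d-tail d-inner cheap
    ... | no ¬found                  = no-neighbours (λ d d-tail d-inner → ¬found (d , d-tail , d-inner))

proposition4p1 : (n : ℕ) → n ≥ 1 → (G : Graph (Fin n)) → Is0MapGraph G →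
    ∃[ v ] IsUnionOf3Cliques G (neighbourhood G v)
proposition4p1 (suc n) _ G (m , H , bipartite , (M , spherical , R) , G-spec)
  with any? (λ x → vertexCost H bipartite M R x <? 12)
... | yes (x , cheap) =
  x , Cliques.cover3⇒union G (neighbourhood G x) (cheap-cover H bipartite M R G G-spec x cheap)
-- Now every nation costs at least 12. The nation `zero`, available as the graph is nonempty,
-- guarantees a dart.
... | no ¬cheap =
  contradiction spherical (not-spherical H bipartite M R (λ x → ≮⇒≥ (λ cheap → ¬cheap (x , cheap))) zero)
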